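{- (1) $\mathrm{S}$ is $\Pi^0_1$-complete. (2) $\mathrm{T}$, $\mathrm{ET}$, and $\mathrm{T}\cap\mathrm{S}$ are $\Pi^0_2$-complete. (3) $H_i$ and $H_{ii}$ are $\Sigma^0_1$-complete; $H_{iii}$ is $\Pi^0_1$-complete.
   Context: $(\varphi_e)_{e\in\mathbb{N}}$ is a fixed standard acceptable numbering of the unary partial computable functions and $\mathbf{M}=\{p\in\mathbb{N}:\varphi_p(0)\!\downarrow=1\}$. Define the following sets of indices (over the standard domain $(\mathbb{N},\mathbf{M})$): $\mathrm{S}=\{a:\forall p\,(\varphi_a(p)\!\downarrow=1\Rightarrow p\notin\mathbf{M})\}$ (sound adjudicators); $\mathrm{T}=\{a:\forall p\ \varphi_a(p)\!\downarrow\}$ (total adjudicators); $\mathrm{ET}=\{a:\forall p\ \varphi_a(p)\!\downarrow=1\}$. Fix a total computable function $d$ with the following property, writing $\delta_a=d(a)$: for every $a$, $\varphi_{\delta_a}(0)$ converges to $1$ if $\varphi_a(\delta_a)\!\downarrow=1$, converges to $0$ if $\varphi_a(\delta_a)\!\downarrow\neq1$, and diverges if $\varphi_a(\delta_a)\!\uparrow$ (so $\delta_a\in\mathbf{M}\iff\varphi_a(\delta_a)\!\downarrow=1$); such $d$ exists by the recursion theorem with parameters. Then $H_i=\{a:\varphi_a(\delta_a)\!\downarrow=1\}$, $H_{ii}=\{a:\varphi_a(\delta_a)\!\downarrow\neq1\}$ (converges with a value other than $1$), $H_{iii}=\{a:\varphi_a(\delta_a)\!\uparrow\}$. Completeness is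 with respect to many-one reducibility. -}

module Defs where

open import Data.Fin.Base using (Fin)
open import Data.Nat.Base using (ℕ; zero; suc; _<_)
open import Data.Product.Base using (∃; _×_)
open import Data.Sum.Base using (_⊎_)
open import Data.Vec.Base using (Vec; []; _∷_; head; lookup)
open import Data.Vec.Relation.Binary.Pointwise.Inductive using (Pointwise)
open import Function.Base using (_∘_)
open import Function.Bundles using (_⇔_)
open import Level using (0ℓ) renaming (suc to lsuc)
open import Relation.Binary.PropositionalEquality.Core using (_≡_; _≢_)
open import Relation.Nullary.Negation.Core using (¬_)
open import Relation.Unary using (Pred)

data μRec : ℕ → Set where
  zer  : μRec 0
  succ : μRec 1
  proj : ∀ {n} → Fin n → μRec n
  comp : ∀ {m n} → μRec m → Vec (μRec n) m → μRec n
  prec : ∀ {n} → μRec n → μRec (suc (suc n)) → μRec (suc n)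
  mu   : ∀ {n} → μRec (suc n) → μRec n

infix 4 _[_]⇓_

-- c [ xs ]⇓ y : the function defined by c converges on xs with value y.
-- Primitive recursion and minimisation both act on the first argument.
data _[_]⇓_ : ∀ {n} → μRec n → Vec ℕ n → ℕ → Set where
  ⇓zer   : zer [ [] ]⇓ 0
  ⇓succ  : ∀ {x} → succ [ x ∷ [] ]⇓ suc x
  ⇓proj  : ∀ {n} {i : Fin n} {xs} → proj i [ xs ]⇓ lookup xs i
  ⇓comp  : ∀ {m n} {f : μRec m} {gs : Vec (μRec n) m} {xs ys z} →
           Pointwise (λ g y → g [ xs ]⇓ y) gs ys →
           f [ ys ]⇓ z → comp f gs [ xs ]⇓ z
  ⇓prec₀ : ∀ {n} {f : μRec n} {g xs y} →
           f [ xs ]⇓ y → prec f g [ 0 ∷ xs ]⇓ y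
  ⇓precₛ : ∀ {n} {f : μRec n} {g xs k y z} →
           prec f g [ k ∷ xs ]⇓ y → g [ k ∷ y ∷ xs ]⇓ z →
           prec f g [ suc k ∷ xs ]⇓ z
  ⇓mu    : ∀ {n} {f : μRec (suc n)} {xs y} →
           (∀ i → i < y → ∃ λ k → f [ i ∷ xs ]⇓ suc k) →
           f [ y ∷ xs ]⇓ 0 → mu f [ xs ]⇓ y

Computable : ∀ {k} → (Vec ℕ k → ℕ) → Set
Computable {k} f = ∃ λ (c : μRec k) → ∀ xs → c [ xs ]⇓ f xs

Computable₁ : (ℕ → ℕ) → Set
Computable₁ f = Computable {1} (f ∘ head)

ComputableRel : ∀ {k} → Pred (Vec ℕ k) 0ℓ → Set
ComputableRel {k} R = ∃ λ (χ : Vec ℕ k → ℕ) → Computable χ ×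
  (∀ xs → (R xs × χ xs ≡ 1) ⊎ (¬ R xs × χ xs ≡ 0))

mutual
  data IsΣ⁰ {k} : ℕ → Pred (Vec ℕ k) 0ℓ → Set (lsuc 0ℓ) where
    computable : ∀ {P} → ComputableRel P → IsΣ⁰ 0 P
    exists     : ∀ {n P} {R : Pred (Vec ℕ (suc k)) 0ℓ} → IsΠ⁰ n R →
                 (∀ xs → P xs ⇔ (∃ λ m → R (m ∷ xs))) → IsΣ⁰ (suc n) P

  data IsΠ⁰ {k} : ℕ → Pred (Vec ℕ k) 0ℓ → Set (lsuc 0ℓ) where
    computable : ∀ {P} → ComputableRel P → IsΠ⁰ 0 P
    forAll     : ∀ {n P} {R : Pred (Vec ℕ (suc k)) 0ℓ} → IsΣ⁰ n R →
                 (∀ xs → P xs ⇔ (∀ m → R (m ∷ xs))) → IsΠ⁰ (suc n) P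

Σ⁰ Π⁰ : ℕ → Pred (Pred ℕ 0ℓ) (lsuc 0ℓ)
Σ⁰ n A = IsΣ⁰ {1} n (A ∘ head)
Π⁰ n A = IsΠ⁰ {1} n (A ∘ head)

infix 4 _≤ₘ_

_≤ₘ_ : Pred ℕ 0ℓ → Pred ℕ 0ℓ → Set
A ≤ₘ B = ∃ λ f → Computable₁ f × (∀ x → A x ⇔ B (f x))

infix 4 _-complete_

_-complete_ : Pred (Pred ℕ 0ℓ) (lsuc 0ℓ) → Pred (Pred ℕ 0ℓ) (lsuc 0ℓ)
Γ -complete A = Γ A × (∀ B → Γ B → B ≤ₘ A)

-- φ e x is the graph of φₑ at x: φ e x y means that φₑ(x) converges to y.
-- Acceptability is the enumeration theorem together with the s-m-n theorem
-- (in its parametrisation form). The former makes each φₑ partial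
-- computable (and single-valued), and the latter, applied to a function
-- ignoring its first argument, makes every unary partial computable
-- function occur as some φₑ.
record AcceptableNumbering : Set (lsuc 0ℓ) where
  field
    φ         : ℕ → ℕ → ℕ → Set
    universal : ∃ λ (u : μRec 2) →
                ∀ e x y → φ e x y ⇔ u [ e ∷ x ∷ [] ]⇓ y
    smn       : ∀ (c : μRec 2) → ∃ λ s → Computable₁ s ×
                (∀ e x y → φ (s e) x y ⇔ c [ e ∷ x ∷ [] ]⇓ y)

-- Convergence and divergence of a partial value v, where v y means that
-- the value is defined and equal to y.
infix 4 _↓ _↑ _↓=_ _↓≠_

_↓ _↑ : Pred ℕ 0ℓ → Set
v ↓ = ∃ λ y → v y
v ↑ = ¬ (v ↓)

_↓=_ _↓≠_ : Pred ℕ 0ℓ → ℕ → Set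
v ↓= y = v y
v ↓≠ y = ∃ λ z → v z × z ≢ y

module Adjudicators (𝒩 : AcceptableNumbering) where
  open AcceptableNumbering 𝒩

  M S T ET : Pred ℕ 0ℓ
  M p  = φ p 0 ↓= 1
  S a  = ∀ p → φ a p ↓= 1 → ¬ M p
  T a  = ∀ p → φ a p ↓
  ET a = ∀ p → φ a p ↓= 1

  record IsDiagonal (d : ℕ → ℕ) : Set where
    field
      d-computable : Computable₁ d
      accepts      : ∀ a → φ a (d a) ↓= 1 → φ (d a) 0 ↓= 1
      rejects      : ∀ a → φ a (d a) ↓≠ 1 → φ (d a) 0 ↓= 0
      diverges     : ∀ a → φ a (d a) ↑ → φ (d a) 0 ↑

  Hᵢ Hᵢᵢ Hᵢᵢᵢ : (ℕ → ℕ) → Pred ℕ 0ℓ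
  Hᵢ   d a = φ a (d a) ↓= 1
  Hᵢᵢ  d a = φ a (d a) ↓≠ 1
  Hᵢᵢᵢ d a = φ a (d a) ↑

{-# OPTIONS --safe #-}

-- A code c is approximated by total computable stages: at stage t, every
-- minimisation in c searches only below t.  The stages are sound, and if c
-- converges on xs to y then almost all stages return y.  Hence φₑ(x) = y is Σ⁰₁
-- and, when true, witnessed by almost all stages, so that a single number can bound
-- both the input and the running time; this places all the index sets in their
-- classes without a pairing function.  For hardness, an unbounded search for a
-- witness, followed by a fixed output, is turned into a reduction by s-m-n.
module Submission where

open import Data.Empty using (⊥-elim)
open import Data.Fin.Base using (Fin; suc; _↑ʳ_)
open import Data.Fin.Patterns using (0F; 1F; 2F; 3F)
open import Data.Nat.Base using (ℕ; zero; suc; pred; _+_; _≤_; _<_; _⊔_; s≤s)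
open import Data.Nat.Properties
open import Data.Product.Base using (∃; _×_; _,_; proj₁; proj₂; map₂)
open import Data.Sum.Base using (_⊎_; inj₁; inj₂)
open import Data.Vec.Base using (Vec; []; _∷_; head; tail; lookup; drop; map; tabulate)
open import Data.Vec.Relation.Binary.Pointwise.Inductive using (Pointwise; []; _∷_)
open import Function.Base using (_∘_; _$_; id)
open import Function.Bundles using (_⇔_; mk⇔; Equivalence)
open import Function.Construct.Composition using (_⇔-∘_)
open import Level using (0ℓ)
open import Relation.Binary.PropositionalEquality using (_≡_; _≢_; _≗_; refl; sym; trans; cong; subst)
open import Relation.Nullary.Decidable.Core using (yes; no; decidable-stable)
open import Relation.Nullary.Negation.Core using (¬_)
open import Relation.Unary using (Pred; Decidable; _∩_)
open import Defs

open Equivalence using (to; from)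

private
  variable
    k m n : ℕ

-- Closure properties of the total computable functions

ComputableVec : (Vec ℕ k → Vec ℕ m) → Set
ComputableVec {k} {m} G = ∃ λ (gs : Vec (μRec k) m) →
  ∀ xs → Pointwise (λ g y → g [ xs ]⇓ y) gs (G xs)

computable-resp : {f g : Vec ℕ k → ℕ} → f ≗ g → Computable f → Computable g
computable-resp f≗g (c , c⇓) = c , λ xs → subst (c [ xs ]⇓_) (f≗g xs) (c⇓ xs)

infix 5 _⟨_⟩

_⟨_⟩ : {f : Vec ℕ m → ℕ} {G : Vec ℕ k → Vec ℕ m} →
       Computable f → ComputableVec G → Computable (f ∘ G)
_⟨_⟩ {G = G} (c , c⇓) (gs , gs⇓) = comp c gs , λ xs → ⇓comp (gs⇓ xs) (c⇓ (G xs))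

infixr 5 _◂_

ε : ComputableVec {k} (λ _ → [])
ε = [] , λ _ → []

_◂_ : {f : Vec ℕ k → ℕ} {G : Vec ℕ k → Vec ℕ m} →
      Computable f → ComputableVec G → ComputableVec (λ xs → f xs ∷ G xs)
(c , c⇓) ◂ (gs , gs⇓) = c ∷ gs , λ xs → c⇓ xs ∷ gs⇓ xs

∘-computable : {G : Vec ℕ m → Vec ℕ n} {H : Vec ℕ k → Vec ℕ m} →
               ComputableVec G → ComputableVec H → ComputableVec (G ∘ H)
∘-computable {H = H} (gs , gs⇓) (hs , hs⇓) =
  map (λ g → comp g hs) gs , λ xs → go xs (gs⇓ (H xs))
  where
  go : ∀ xs {l} {gs : Vec (μRec _) l} {ys : Vec ℕ l} → Pointwise (λ g y → g [ H xs ]⇓ y) gs ys →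
       Pointwise (λ g y → g [ xs ]⇓ y) (map (λ g → comp g hs) gs) ys
  go xs []         = []
  go xs (g⇓ ∷ gs⇓) = ⇓comp (hs⇓ xs) g⇓ ∷ go xs gs⇓

var : (i : Fin k) → Computable (λ xs → lookup xs i)
var i = proj i , λ _ → ⇓proj

suc-computable : {f : Vec ℕ k → ℕ} → Computable f → Computable (suc ∘ f)
suc-computable f = _⟨_⟩ {f = suc ∘ head} (succ , λ where (_ ∷ []) → ⇓succ) (f ◂ ε)

const-computable : ∀ a → Computable {k} (λ _ → a)
const-computable zero    = _⟨_⟩ {f = λ _ → 0} (zer , λ where [] → ⇓zer) ε
const-computable (suc a) = suc-computable (const-computable a)

-- With `var` and `_◂_` this expresses the rearrangements of arguments used below;
-- `drop-computable 0` is the identity.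
drop-computable : ∀ m → ComputableVec {m + k} (drop m)
drop-computable m = tabulate (λ i → proj (m ↑ʳ i)) , λ xs →
  pointwise (λ i → subst (proj (m ↑ʳ i) [ xs ]⇓_) (lookup-drop m xs i) ⇓proj)
  where
  lookup-drop : ∀ m (xs : Vec ℕ (m + n)) i → lookup xs (m ↑ʳ i) ≡ lookup (drop m xs) i
  lookup-drop zero    xs       i = refl
  lookup-drop (suc m) (_ ∷ xs) i = lookup-drop m xs i

  pointwise : ∀ {A : Set} {_∼_ : A → ℕ → Set} {f : Fin n → A} {ys : Vec ℕ n} →
              (∀ i → f i ∼ lookup ys i) → Pointwise _∼_ (tabulate f) ys
  pointwise {ys = []}    p = []
  pointwise {ys = _ ∷ _} p = p 0F ∷ pointwise (p ∘ suc)

-- `F` need only satisfy the recursion equations, so functions defined by pattern matching are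
-- covered directly.
prec-computable : {F : Vec ℕ (suc k) → ℕ} {f : Vec ℕ k → ℕ} {g : Vec ℕ (suc (suc k)) → ℕ} →
                  Computable f → Computable g →
                  (∀ xs → f xs ≡ F (0 ∷ xs)) →
                  (∀ i xs → g (i ∷ F (i ∷ xs) ∷ xs) ≡ F (suc i ∷ xs)) →
                  Computable F
prec-computable {F = F} (c , c⇓) (d , d⇓) base step = prec c d , λ where (i ∷ xs) → go i xs
  where
  go : ∀ i xs → prec c d [ i ∷ xs ]⇓ F (i ∷ xs)
  go zero    xs = ⇓prec₀ (subst (c [ xs ]⇓_) (base xs) (c⇓ xs))
  go (suc i) xs = ⇓precₛ (go i xs) (subst (d [ _ ]⇓_) (step i xs) (d⇓ _))

caseℕ : ℕ → ℕ → (ℕ → ℕ) → ℕ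
caseℕ zero    z s = z
caseℕ (suc i) z s = s i

case-computable : {a f : Vec ℕ k → ℕ} {g : Vec ℕ (suc k) → ℕ} →
                  Computable a → Computable f → Computable g →
                  Computable (λ xs → caseℕ (a xs) (f xs) (λ i → g (i ∷ xs)))
case-computable {f = f} {g} ca cf cg =
  prec-computable {F = λ xs → caseℕ (head xs) (f (tail xs)) (λ i → g (i ∷ tail xs))}
    cf (cg ⟨ var 0F ◂ drop-computable 2 ⟩) (λ _ → refl) (λ _ _ → refl)
  ⟨ ca ◂ drop-computable 0 ⟩

-- Stages of a computation: 0 stands for "undefined" and suc y for the value y.

foldStages : ℕ → (ℕ → ℕ → ℕ) → ℕ → ℕ
foldStages a b zero    = a
foldStages a b (suc i) = caseℕ (foldStages a b i) 0 (b i)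

-- search r j is 0 if all r i with i < j are defined and positive, 1 if an
-- undefined r i is met first, and 2 + i if a zero is met first, at i.
search : (ℕ → ℕ) → ℕ → ℕ
search r zero    = 0
search r (suc j) = caseℕ (search r j) (caseℕ (r j) 1 λ v → caseℕ v (2 + j) (λ _ → 0)) suc

stage   : μRec n → ℕ → Vec ℕ n → ℕ
defined : Vec (μRec n) m → ℕ → Vec ℕ n → ℕ
-- An undefined entry becomes 0 through `pred`; the vector is meaningful only when `defined` is
-- nonzero, which `stage` tests first at `comp`.
values  : Vec (μRec n) m → ℕ → Vec ℕ n → Vec ℕ m

stage zer         t xs       = 1
stage succ        t xs       = 2 + head xs
stage (proj i)    t xs       = suc (lookup xs i)
stage (comp f gs) t xs       = caseℕ (defined gs t xs) 0 (λ _ → stage f t (values gs t xs))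
stage (prec f g)  t (i ∷ xs) = foldStages (stage f t xs) (λ j y → stage g t (j ∷ y ∷ xs)) i
-- `pred` sends the verdicts 0 and 1 both to "undefined", and `2 + y` to the stage encoding of `y`.
stage (mu f)      t xs       = pred (search (λ i → stage f t (i ∷ xs)) t)

defined []       t xs = 1
defined (g ∷ gs) t xs = caseℕ (stage g t xs) 0 (λ _ → defined gs t xs)

values []       t xs = []
values (g ∷ gs) t xs = pred (stage g t xs) ∷ values gs t xs

-- Computability of the stages.

pred-computable : {f : Vec ℕ k → ℕ} → Computable f → Computable (pred ∘ f)
pred-computable {f = f} cf =
  computable-resp (λ xs → lemma (f xs)) (case-computable cf (const-computable 0) (var 0F))
  where
  lemma : ∀ a → caseℕ a 0 id ≡ pred a
  lemma zero    = refl
  lemma (suc a) = refl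

uncurryStage : (ℕ → Vec ℕ n → ℕ) → Vec ℕ (suc n) → ℕ
uncurryStage s ts = s (head ts) (tail ts)

stage-computable   : (c : μRec n) → Computable (uncurryStage (stage c))
defined-computable : (gs : Vec (μRec n) m) → Computable (uncurryStage (defined gs))
values-computable  : (gs : Vec (μRec n) m) →
                     ComputableVec (λ ts → values gs (head ts) (tail ts))

stage-computable zer = const-computable 1
stage-computable succ =
  computable-resp (λ where (_ ∷ _ ∷ _) → refl) (suc-computable (suc-computable (var 1F)))
stage-computable (proj i) =
  computable-resp (λ where (_ ∷ _) → refl) (suc-computable (var (suc i)))
stage-computable (comp f gs) =
  computable-resp (λ where (_ ∷ _) → refl) $
    case-computable (defined-computable gs) (const-computable 0)
      ((stage-computable f ⟨ var 0F ◂ values-computable gs ⟩) ⟨ drop-computable 1 ⟩)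
stage-computable (prec f g) =
  computable-resp (λ where (_ ∷ _ ∷ _) → refl) $
    -- `prec` recurses on its first argument but stages take `t` first: the recursion runs with the
    -- two exchanged, and the final substitution exchanges them back.
    prec-computable
      {F = λ where (i ∷ t ∷ xs) → stage (prec f g) t (i ∷ xs)}
      (stage-computable f)
      (case-computable (var 1F) (const-computable 0)
        (stage-computable g ⟨ var 3F ◂ var 1F ◂ var 0F ◂ drop-computable 4 ⟩))
      (λ where (_ ∷ _) → refl)
      (λ where _ (_ ∷ _) → refl)
    ⟨ var 1F ◂ var 0F ◂ drop-computable 2 ⟩
stage-computable (mu f) =
  computable-resp (λ where (_ ∷ _) → refl) $ pred-computable $
    prec-computable
      {F = λ where (j ∷ t ∷ xs) → search (λ i → stage f t (i ∷ xs)) j}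
      (const-computable 0)
      (case-computable (var 1F)
        (case-computable (stage-computable f ⟨ var 2F ◂ var 0F ◂ drop-computable 3 ⟩)
          (const-computable 1)
          (case-computable (var 0F) (suc-computable (suc-computable (var 1F))) (const-computable 0)))
        (suc-computable (var 0F)))
      (λ where (_ ∷ _) → refl)
      (λ where _ (_ ∷ _) → refl)
    -- Duplicating `t` makes it both the length of the search and the stage at which `f` is
    -- evaluated.
    ⟨ var 0F ◂ drop-computable 0 ⟩

defined-computable []       = const-computable 1
defined-computable (g ∷ gs) =
  case-computable (stage-computable g) (const-computable 0)
    (defined-computable gs ⟨ drop-computable 1 ⟩)

values-computable []       = ε
values-computable (g ∷ gs) = pred-computable (stage-computable g) ◂ values-computable gs

-- Soundness of the stages.

search-running : ∀ r j → search r j ≡ 0 → ∀ i → i < j → ∃ λ v → r i ≡ 2 + v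
search-running r (suc j) eq i (s≤s i≤j) with search r j in eqₛ | r j in eqᵣ
... | 0 | suc (suc v) with m≤n⇒m<n∨m≡n i≤j
...   | inj₁ i<j  = search-running r j eqₛ i i<j
...   | inj₂ refl = v , eqᵣ

-- The verdict either arises at the last index, with the search running until then, or is inherited
-- from a shorter search.
search-found : ∀ r j {y} → search r j ≡ 2 + y →
               r y ≡ 1 × (∀ i → i < y → ∃ λ v → r i ≡ 2 + v)
search-found r (suc j) eq with search r j in eqₛ | r j in eqᵣ
search-found r (suc j) refl | 0     | 1 = eqᵣ , search-running r j eqₛ
search-found r (suc j) refl | suc _ | _ = search-found r j eqₛ

-- A positive stage forces positive stages, at the same `t`, for everything it was computed from;
-- the derivation is assembled from these.
stage-sound   : (c : μRec n) → ∀ {t xs y} → stage c t xs ≡ suc y → c [ xs ]⇓ y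
defined-sound : (gs : Vec (μRec n) m) → ∀ {t xs y} → defined gs t xs ≡ suc y →
                Pointwise (λ g z → g [ xs ]⇓ z) gs (values gs t xs)

stage-sound zer      {xs = []}     refl = ⇓zer
stage-sound succ     {xs = _ ∷ []} refl = ⇓succ
stage-sound (proj i)               refl = ⇓proj
stage-sound (comp f gs) {t} {xs} eq with defined gs t xs in eqd
... | suc _ = ⇓comp (defined-sound gs eqd) (stage-sound f eq)
stage-sound (prec f g) {t} {i ∷ xs} = go i
  where
  go : ∀ i {y} → stage (prec f g) t (i ∷ xs) ≡ suc y → prec f g [ i ∷ xs ]⇓ y
  go zero    eq = ⇓prec₀ (stage-sound f eq)
  go (suc i) eq with stage (prec f g) t (i ∷ xs) in eqᵢ
  ... | suc _ = ⇓precₛ (go i eqᵢ) (stage-sound g eq)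
stage-sound (mu f) {t} {xs} eq with search (λ i → stage f t (i ∷ xs)) t in eqₛ
stage-sound (mu f) {t} {xs} refl | suc (suc y) =
  let zero-at-y , positive = search-found _ t eqₛ in
  ⇓mu (λ i i<y → map₂ (stage-sound f) (positive i i<y)) (stage-sound f zero-at-y)

defined-sound []       eq = []
defined-sound (g ∷ gs) {t} {xs} eq with stage g t xs in eqₛ
... | suc _ = stage-sound g eqₛ ∷ defined-sound gs eq

-- Completeness of the stages.

Eventually : (ℕ → Set) → Set
Eventually P = ∃ λ b → ∀ t → b ≤ t → P t

eventually-map : {P Q : ℕ → Set} → (∀ {t} → P t → Q t) → Eventually P → Eventually Q
eventually-map f (b , p) = b , λ t b≤t → f (p t b≤t)

-- This is why completeness speaks of almost all stages: several computations are brought to a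
-- common stage without a proof that stages are monotone in `t`.
eventually-× : {P Q : ℕ → Set} → Eventually P → Eventually Q → Eventually (λ t → P t × Q t)
eventually-× (b , p) (b′ , q) =
  b ⊔ b′ , λ t b≤t → p t (m⊔n≤o⇒m≤o b b′ b≤t) , q t (m⊔n≤o⇒n≤o b b′ b≤t)

∀<-suc : {P : ℕ → Set} → ∀ {y} → (∀ i → i < y → P i) → P y → ∀ i → i < suc y → P i
∀<-suc p q i (s≤s i≤y) with m≤n⇒m<n∨m≡n i≤y
... | inj₁ i<y  = p i i<y
... | inj₂ refl = q

-- Finitely many thresholds have a maximum; for `mu` this treats all arguments below the minimum at
-- once.
eventually-∀< : {P : ℕ → ℕ → Set} → ∀ y → (∀ i → i < y → Eventually (P i)) →
                Eventually (λ t → ∀ i → i < y → P i t)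
eventually-∀< zero    h = 0 , λ _ _ _ ()
eventually-∀< {P} (suc y) h =
  eventually-map (λ {t} (p , q) → ∀<-suc {P = λ i → P i t} p q)
    (eventually-× (eventually-∀< y (λ i → h i ∘ m<n⇒m<1+n)) (h y (n<1+n y)))

search-skips : ∀ r j → (∀ i → i < j → ∃ λ v → r i ≡ 2 + v) → search r j ≡ 0
search-skips r zero    pos = refl
search-skips r (suc j) pos
  rewrite search-skips r j (λ i → pos i ∘ m<n⇒m<1+n) | proj₂ (pos j (n<1+n j)) = refl

search-finds : ∀ r {j y} → y < j → (∀ i → i < y → ∃ λ v → r i ≡ 2 + v) → r y ≡ 1 →
               search r j ≡ 2 + y
search-finds r {suc j} (s≤s y≤j) pos eq with m≤n⇒m<n∨m≡n y≤j
... | inj₁ y<j rewrite search-finds r y<j pos eq = refl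
... | inj₂ refl rewrite search-skips r j pos | eq = refl

stage-complete   : (c : μRec n) → ∀ {xs y} → c [ xs ]⇓ y →
                   Eventually (λ t → stage c t xs ≡ suc y)
defined-complete : (gs : Vec (μRec n) m) → ∀ {xs ys} → Pointwise (λ g y → g [ xs ]⇓ y) gs ys →
                   Eventually (λ t → defined gs t xs ≡ 1 × values gs t xs ≡ ys)

stage-complete zer      ⇓zer  = 0 , λ _ _ → refl
stage-complete succ     ⇓succ = 0 , λ _ _ → refl
stage-complete (proj i) ⇓proj = 0 , λ _ _ → refl
stage-complete (comp f gs) {xs} {y} (⇓comp gs⇓ f⇓) =
  eventually-map combine (eventually-× (defined-complete gs gs⇓) (stage-complete f f⇓))
  where
  combine : ∀ {t ys} → (defined gs t xs ≡ 1 × values gs t xs ≡ ys) × stage f t ys ≡ suc y →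
            stage (comp f gs) t xs ≡ suc y
  combine ((d , refl) , e) rewrite d = e
stage-complete (prec f g) (⇓prec₀ f⇓) = stage-complete f f⇓
stage-complete (prec f g) {suc i ∷ xs} {z} (⇓precₛ rec⇓ g⇓) =
  eventually-map combine (eventually-× (stage-complete (prec f g) rec⇓) (stage-complete g g⇓))
  where
  combine : ∀ {t y} → stage (prec f g) t (i ∷ xs) ≡ suc y × stage g t (i ∷ y ∷ xs) ≡ suc z →
            stage (prec f g) t (suc i ∷ xs) ≡ suc z
  combine (d , e) rewrite d = e
stage-complete (mu f) {xs} {y} (⇓mu pos f⇓) =
  eventually-map (λ (y<t , p , e) → cong pred (search-finds _ y<t p e))
    -- The stage must exceed `y`, since the search inspects only indices below `t`.
    (eventually-× (suc y , λ _ y<t → y<t)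
      (eventually-×
        (eventually-∀< y λ i i<y → let v , f⇓ᵢ = pos i i<y in
          eventually-map (v ,_) (stage-complete f f⇓ᵢ))
        (stage-complete f f⇓)))

defined-complete []       []          = 0 , λ _ _ → refl , refl
defined-complete (g ∷ gs) {xs} (_∷_ {y = y} {ys = ys} g⇓ gs⇓) =
  eventually-map combine (eventually-× (stage-complete g g⇓) (defined-complete gs gs⇓))
  where
  combine : ∀ {t} → stage g t xs ≡ suc y × (defined gs t xs ≡ 1 × values gs t xs ≡ ys) →
            defined (g ∷ gs) t xs ≡ 1 × values (g ∷ gs) t xs ≡ y ∷ ys
  combine (e , d , refl) rewrite e = d , refl

-- One sufficiently late stage returns both values, and a stage is a function.
⇓-functional : (c : μRec n) → ∀ {xs y z} → c [ xs ]⇓ y → c [ xs ]⇓ z → y ≡ z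
⇓-functional c p q =
  let b , h = eventually-× (stage-complete c p) (stage-complete c q)
      e , e′ = h b ≤-refl
  in suc-injective (trans (sym e) e′)

-- Computable relations

decide : {R : Pred (Vec ℕ k) 0ℓ} → ComputableRel R → Decidable R
decide (_ , _ , h) xs with h xs
... | inj₁ (r , _) = yes r
... | inj₂ (¬r , _) = no ¬r

infix 5 _⟪_⟫

_⟪_⟫ : {R : Pred (Vec ℕ m) 0ℓ} {G : Vec ℕ k → Vec ℕ m} →
       ComputableRel R → ComputableVec G → ComputableRel (R ∘ G)
_⟪_⟫ {G = G} (χ , cχ , h) cG = χ ∘ G , cχ ⟨ cG ⟩ , h ∘ G

¬-computable : {R : Pred (Vec ℕ k) 0ℓ} → ComputableRel R → ComputableRel (λ xs → ¬ R xs)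
¬-computable {R = R} (χ , cχ , h) =
  _ , case-computable cχ (const-computable 1) (const-computable 0) , λ xs → go (h xs)
  where
  go : ∀ {xs a} → (R xs × a ≡ 1) ⊎ (¬ R xs × a ≡ 0) →
       (¬ R xs × caseℕ a 1 (λ _ → 0) ≡ 1) ⊎ (¬ ¬ R xs × caseℕ a 1 (λ _ → 0) ≡ 0)
  go (inj₁ (r , refl))  = inj₂ ((λ ¬r → ¬r r) , refl)
  go (inj₂ (¬r , refl)) = inj₁ (¬r , refl)

×-computable : {Q R : Pred (Vec ℕ k) 0ℓ} → ComputableRel Q → ComputableRel R →
               ComputableRel (λ xs → Q xs × R xs)
×-computable {Q = Q} {R} (χ , cχ , h) (ψ , cψ , h′) =
  _ , case-computable cχ (const-computable 0) (cψ ⟨ drop-computable 1 ⟩) , λ xs → go (h xs) (h′ xs)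
  where
  go : ∀ {xs a b} → (Q xs × a ≡ 1) ⊎ (¬ Q xs × a ≡ 0) → (R xs × b ≡ 1) ⊎ (¬ R xs × b ≡ 0) →
       ((Q xs × R xs) × caseℕ a 0 (λ _ → b) ≡ 1) ⊎ (¬ (Q xs × R xs) × caseℕ a 0 (λ _ → b) ≡ 0)
  go (inj₁ (q , refl))  (inj₁ (r , e))  = inj₁ ((q , r) , e)
  go (inj₁ (q , refl))  (inj₂ (¬r , e)) = inj₂ (¬r ∘ proj₂ , e)
  go (inj₂ (¬q , refl)) _               = inj₂ (¬q ∘ proj₁ , refl)

∀<-computable : {R : Pred (Vec ℕ (suc k)) 0ℓ} → ComputableRel R →
                ComputableRel (λ xs → ∀ i → i < head xs → R (i ∷ tail xs))
∀<-computable {k} {R} (χ , cχ , h) =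
  (λ xs → all (head xs) (tail xs)) ,
  prec-computable (const-computable 1)
    (case-computable (cχ ⟨ var 0F ◂ drop-computable 2 ⟩) (const-computable 0) (var 2F))
    (λ _ → refl) (λ _ _ → refl) ,
  λ where (b ∷ xs) → correct b xs
  where
  all : ℕ → Vec ℕ k → ℕ
  all zero    xs = 1
  all (suc b) xs = caseℕ (χ (b ∷ xs)) 0 (λ _ → all b xs)

  correct : ∀ b xs → ((∀ i → i < b → R (i ∷ xs)) × all b xs ≡ 1) ⊎
                     (¬ (∀ i → i < b → R (i ∷ xs)) × all b xs ≡ 0)
  correct zero    xs = inj₁ ((λ _ ()) , refl)
  correct (suc b) xs with χ (b ∷ xs) | h (b ∷ xs) | correct b xs
  ... | _ | inj₂ (¬r , refl) | _              = inj₂ ((λ p → ¬r (p b (n<1+n b))) , refl)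
  ... | _ | inj₁ (r , refl)  | inj₂ (¬p , e) = inj₂ ((λ p → ¬p (λ i → p i ∘ m<n⇒m<1+n)) , e)
  ... | _ | inj₁ (r , refl)  | inj₁ (p , e)  = inj₁ (∀<-suc {P = λ i → R (i ∷ xs)} p r , e)

-- Since `a` is a fixed numeral, the test is a nest of case distinctions built by recursion on `a`
-- outside the codes.
≡-computable : {f : Vec ℕ k → ℕ} → Computable f → ∀ a → ComputableRel (λ xs → f xs ≡ a)
≡-computable {f = f} cf a = (λ xs → eq a (f xs)) , eq-computable a ⟨ cf ◂ ε ⟩ , λ xs → correct a (f xs)
  where
  eq : ℕ → ℕ → ℕ
  eq zero    b = caseℕ b 1 (λ _ → 0)
  eq (suc a) b = caseℕ b 0 (eq a)

  eq-computable : ∀ a → Computable {1} (λ xs → eq a (head xs))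
  eq-computable zero    =
    computable-resp (λ where (_ ∷ []) → refl)
      (case-computable (var 0F) (const-computable 1) (const-computable 0))
  eq-computable (suc a) =
    computable-resp (λ where (_ ∷ []) → refl)
      (case-computable (var 0F) (const-computable 0) (eq-computable a ⟨ var 0F ◂ ε ⟩))

  correct : ∀ a b → (b ≡ a × eq a b ≡ 1) ⊎ (b ≢ a × eq a b ≡ 0)
  correct zero    zero    = inj₁ (refl , refl)
  correct zero    (suc b) = inj₂ ((λ ()) , refl)
  correct (suc a) zero    = inj₂ ((λ ()) , refl)
  correct (suc a) (suc b) with correct a b
  ... | inj₁ (p , e)  = inj₁ (cong suc p , e)
  ... | inj₂ (¬p , e) = inj₂ (¬p ∘ suc-injective , e)

-- Witnesses and unbounded search.

Σ⁰₁-preimage : {P : Pred (Vec ℕ m) 0ℓ} {G : Vec ℕ k → Vec ℕ m} →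
               IsΣ⁰ 1 P → ComputableVec G → IsΣ⁰ 1 (P ∘ G)
Σ⁰₁-preimage {G = G} (exists {R = R} (computable cR) P⇔) cG =
  exists (computable (_⟪_⟫ {R = R} cR (var 0F ◂ ∘-computable cG (drop-computable 1))))
    (λ xs → P⇔ (G xs))

-- The complement is taken in existential form because, constructively, `¬ B x` yields no
-- counterexample. Decidability of `R` gives the equivalence.
Π⁰₁-complement : ∀ {B} → Π⁰ 1 B → ∃ λ C → Σ⁰ 1 C × (∀ x → B x ⇔ (¬ C x))
Π⁰₁-complement (forAll {R = R} (computable cR) B⇔) =
  (λ x → ∃ λ i → ¬ R (i ∷ x ∷ [])) ,
  exists (computable (¬-computable cR)) (λ where (_ ∷ []) → mk⇔ id id) ,
  λ x → mk⇔ (λ b (i , ¬r) → ¬r (to (B⇔ (x ∷ [])) b i))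
            (λ ¬c → from (B⇔ (x ∷ [])) λ i →
              decidable-stable (decide cR (i ∷ x ∷ [])) λ ¬r → ¬c (i , ¬r))

-- `⇓mu` demands positive values at all smaller arguments, so a given zero is replaced by the first
-- one.
least-zero : ∀ (r : ℕ → ℕ) i → r i ≡ 0 →
             ∃ λ y → (∀ i → i < y → ∃ λ v → r i ≡ suc v) × r y ≡ 0
least-zero r i       ri≡0 with r 0 in eq
least-zero r i       ri≡0 | zero = 0 , (λ _ ()) , eq
least-zero r zero    ri≡0 | suc v with () ← trans (sym eq) ri≡0
least-zero r (suc i) ri≡0 | suc v =
  let y , positive , zero-at-y = least-zero (r ∘ suc) i ri≡0 in
  suc y , (λ where zero _ → v , eq ; (suc i) (s≤s i<y) → positive i i<y) , zero-at-y

-- Minimisation converges exactly when a witness exists. Its result is fed to a constant code, and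
-- `⇓comp` requires arguments to converge even then.
searchCode : {P : Pred (Vec ℕ k) 0ℓ} → IsΣ⁰ 1 P → ∀ y →
             ∃ λ c → ∀ xs z → c [ xs ]⇓ z ⇔ (z ≡ y × P xs)
-- Minimisation looks for a zero, so the relation is negated: `χ` vanishes exactly where `R` holds.
searchCode {k} {P} (exists {R = R} (computable cR) P⇔) y with ¬-computable cR
... | χ , (c , c⇓) , h = comp (proj₁ cy) (mu c ∷ []) , λ xs z → mk⇔ run halt
  where
  cy : Computable {1} (λ _ → y)
  cy = const-computable y

  run : ∀ {xs z} → comp (proj₁ cy) (mu c ∷ []) [ xs ]⇓ z → z ≡ y × P xs
  run {xs} (⇓comp {ys = i ∷ []} (⇓mu _ c⇓0 ∷ []) y⇓) =
    ⇓-functional (proj₁ cy) y⇓ (proj₂ cy (i ∷ [])) , from (P⇔ xs) (i , holds)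
    where
    holds : R (i ∷ xs)
    holds with h (i ∷ xs)
    ... | inj₂ (¬¬r , _) = decidable-stable (decide cR (i ∷ xs)) ¬¬r
    ... | inj₁ (_ , e) with () ← trans (sym e) (⇓-functional c (c⇓ _) c⇓0)

  halt : ∀ {xs z} → z ≡ y × P xs → comp (proj₁ cy) (mu c ∷ []) [ xs ]⇓ z
  halt {xs} (refl , p) =
    let j , positive , zero-at-j = least-zero (λ i → χ (i ∷ xs)) i χi≡0 in
    ⇓comp (⇓mu (λ i i<j → map₂ (λ e → subst (c [ _ ]⇓_) e (c⇓ _)) (positive i i<j))
               (subst (c [ j ∷ xs ]⇓_) zero-at-j (c⇓ _)) ∷ [])
          (proj₂ cy (j ∷ []))
    where
    i : ℕ
    i = proj₁ (to (P⇔ xs) p)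

    χi≡0 : χ (i ∷ xs) ≡ 0
    χi≡0 with h (i ∷ xs)
    ... | inj₁ (¬r , _) = ⊥-elim (¬r (proj₂ (to (P⇔ xs) p)))
    ... | inj₂ (_ , e)  = e

-- Index sets of an acceptable numbering

module _ (𝒩 : AcceptableNumbering) where
  open AcceptableNumbering 𝒩
  open Adjudicators 𝒩

  φ-stage : ℕ → ℕ → ℕ → ℕ
  φ-stage t e x = stage (proj₁ universal) t (e ∷ x ∷ [])

  φ-sound : ∀ {e x y} t → φ-stage t e x ≡ suc y → φ e x y
  φ-sound t = from (proj₂ universal _ _ _) ∘ stage-sound (proj₁ universal)

  φ-complete : ∀ {e x y} → φ e x y → Eventually (λ t → φ-stage t e x ≡ suc y)
  φ-complete = stage-complete (proj₁ universal) ∘ to (proj₂ universal _ _ _)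

  φ⇔stage : ∀ {e x y} → φ e x y ⇔ (∃ λ t → φ-stage t e x ≡ suc y)
  φ⇔stage = mk⇔ (λ p → let b , h = φ-complete p in b , h b ≤-refl) (λ (t , e) → φ-sound t e)

  φ-stage-defined : ∀ {e x} t → φ-stage t e x ≢ 0 → φ e x ↓
  φ-stage-defined {e} {x} t ≢0 with φ-stage t e x in eq
  ... | zero  = ⊥-elim (≢0 refl)
  ... | suc y = y , φ-sound t eq

  ↓⇔stage : ∀ {e x} → φ e x ↓ ⇔ (∃ λ t → φ-stage t e x ≢ 0)
  ↓⇔stage = mk⇔
    (λ (y , p) → let t , e = to φ⇔stage p in t , λ z → 0≢1+n (trans (sym z) e))
    (λ (t , ≢0) → φ-stage-defined t ≢0)

  stage-≡-computable : {f g h : Vec ℕ k → ℕ} → Computable f → Computable g → Computable h → ∀ a →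
                       ComputableRel (λ xs → φ-stage (f xs) (g xs) (h xs) ≡ a)
  stage-≡-computable cf cg ch =
    ≡-computable (stage-computable (proj₁ universal) ⟨ cf ◂ cg ◂ ch ◂ ε ⟩)

  -- Membership of the index sets in their classes.

  SoundUpTo : ℕ → ℕ → Set
  SoundUpTo b a = ∀ p → p < b → ¬ (φ-stage b a p ≡ 2 × φ-stage b p 0 ≡ 2)

  -- A violation of soundness is visible at any `b` that exceeds `p` and is late enough for both
  -- computations. The stage value 2 encodes the output 1.
  S⇔soundUpTo : ∀ {a} → S a ⇔ (∀ b → SoundUpTo b a)
  S⇔soundUpTo = mk⇔
    (λ s b p _ (accepted , member) → s p (φ-sound b accepted) (φ-sound b member))
    (λ s p accepted member →
      let b , h = eventually-× (suc p , λ _ p<t → p<t)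
                    (eventually-× (φ-complete accepted) (φ-complete member))
          p<b , e = h b ≤-refl
      in s b p p<b e)

  soundUpTo-computable : {f g : Vec ℕ k → ℕ} → Computable f → Computable g →
                         ComputableRel (λ xs → SoundUpTo (f xs) (g xs))
  soundUpTo-computable cf cg =
    ∀<-computable
      (¬-computable (×-computable
        (stage-≡-computable (var 1F) (var 2F) (var 0F) 2)
        (stage-≡-computable (var 1F) (var 0F) (const-computable 0) 2)))
    ⟪ cf ◂ cf ◂ cg ◂ ε ⟫

  S-Π⁰₁ : Π⁰ 1 S
  S-Π⁰₁ = forAll (computable (soundUpTo-computable (var 0F) (var 1F)))
    λ where (_ ∷ []) → S⇔soundUpTo

  T-Π⁰₂ : Π⁰ 2 T
  T-Π⁰₂ = forAll {R = λ xs → φ (lookup xs 1F) (lookup xs 0F) ↓}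
    (exists (computable (¬-computable (stage-≡-computable (var 0F) (var 2F) (var 1F) 0)))
      λ where (_ ∷ _ ∷ []) → ↓⇔stage)
    λ where (_ ∷ []) → mk⇔ id id

  ET-Π⁰₂ : Π⁰ 2 ET
  ET-Π⁰₂ = forAll {R = λ xs → φ (lookup xs 1F) (lookup xs 0F) ↓= 1}
    (exists (computable (stage-≡-computable (var 0F) (var 2F) (var 1F) 2))
      λ where (_ ∷ _ ∷ []) → φ⇔stage)
    λ where (_ ∷ []) → mk⇔ id id

  -- The variable ranging over inputs for `T` doubles as the bound in `SoundUpTo`. The soundness
  -- part is computable and independent of the stage, so it passes under the existential quantifier.
  T∩S-Π⁰₂ : Π⁰ 2 (T ∩ S)
  T∩S-Π⁰₂ = forAll
    {R = λ xs → φ (lookup xs 1F) (lookup xs 0F) ↓ × SoundUpTo (lookup xs 0F) (lookup xs 1F)}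
    (exists
      (computable (×-computable
        (¬-computable (stage-≡-computable (var 0F) (var 2F) (var 1F) 0))
        (soundUpTo-computable (var 1F) (var 2F))))
      λ where (_ ∷ _ ∷ []) → mk⇔
                (λ (c , s) → let t , ≢0 = to ↓⇔stage c in t , ≢0 , s)
                (λ (t , ≢0 , s) → from ↓⇔stage (t , ≢0) , s))
    λ where (_ ∷ []) → mk⇔
              (λ (t , s) p → t p , to S⇔soundUpTo s p)
              (λ h → proj₁ ∘ h , from S⇔soundUpTo (proj₂ ∘ h))

  module _ (d : ℕ → ℕ) (d-computable : Computable₁ d) where

    private
      δ : Computable (λ (xs : Vec ℕ 2) → d (lookup xs 1F))
      δ = d-computable ⟨ var 1F ◂ ε ⟩

    Hᵢ-Σ⁰₁ : Σ⁰ 1 (Hᵢ d)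
    Hᵢ-Σ⁰₁ = exists (computable (stage-≡-computable (var 0F) (var 1F) δ 2))
      λ where (_ ∷ []) → φ⇔stage

    Hᵢᵢ-Σ⁰₁ : Σ⁰ 1 (Hᵢᵢ d)
    Hᵢᵢ-Σ⁰₁ = exists
      (computable (×-computable
        (¬-computable (stage-≡-computable (var 0F) (var 1F) δ 0))
        (¬-computable (stage-≡-computable (var 0F) (var 1F) δ 2))))
      λ where (_ ∷ []) → mk⇔
                (λ (z , p , z≢1) → let t , e = to φ⇔stage p in
                  t , (λ e′ → 0≢1+n (trans (sym e′) e)) ,
                      (λ e′ → z≢1 (suc-injective (trans (sym e) e′))))
                (λ (t , ≢0 , ≢2) → other t ≢0 ≢2)
      where
      other : ∀ {e x} t → φ-stage t e x ≢ 0 → φ-stage t e x ≢ 2 → φ e x ↓≠ 1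
      other {e} {x} t ≢0 ≢2 with φ-stage t e x in eq
      ... | zero  = ⊥-elim (≢0 refl)
      ... | suc z = z , φ-sound t eq , λ z≡1 → ≢2 (cong suc z≡1)

    Hᵢᵢᵢ-Π⁰₁ : Π⁰ 1 (Hᵢᵢᵢ d)
    Hᵢᵢᵢ-Π⁰₁ = forAll
      -- That the stage is 0 is stated doubly negated, to match the negation of `↓⇔stage`.
      (computable (¬-computable (¬-computable (stage-≡-computable (var 0F) (var 1F) δ 0))))
      λ where (_ ∷ []) → mk⇔
                (λ diverges t ≢0 → diverges (from ↓⇔stage (t , ≢0)))
                (λ h conv → let t , ≢0 = to ↓⇔stage conv in h t ≢0)

  -- Hardness through s-m-n.

  semidecider : {P : Pred (Vec ℕ 2) 0ℓ} → IsΣ⁰ 1 P → ∀ y → ∃ λ s → Computable₁ s ×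
                (∀ e x z → φ (s e) x z ⇔ (z ≡ y × P (e ∷ x ∷ [])))
  semidecider ΣP y =
    let c , c⇔ = searchCode ΣP y
        s , cs , φ⇔ = smn c
    in s , cs , λ e x z → c⇔ (e ∷ x ∷ []) z ⇔-∘ φ⇔ e x z

  -- The searched predicate ignores the input, so `φ (s e)` is constantly `y` or nowhere defined. In
  -- particular its value at `d (s e)` is known, as the diagonal sets require.
  uniform-semidecider : ∀ {B} → Σ⁰ 1 B → ∀ y → ∃ λ s → Computable₁ s ×
                        (∀ e x z → φ (s e) x z ⇔ (z ≡ y × B e))
  uniform-semidecider ΣB = semidecider (Σ⁰₁-preimage ΣB (var 0F ◂ ε))

  -- A member of `M` refutes the soundness of an adjudicator that accepts everything. The one built
  -- here computes the constant 1.
  M-inhabited : ∃ M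
  M-inhabited =
    let always = exists {R = λ _ → 0 ≡ 0} (computable (≡-computable (const-computable 0) 0))
                   (λ _ → mk⇔ (λ z → 0 , z) proj₂)
        s , _ , φ⇔ = uniform-semidecider {λ _ → 0 ≡ 0} always 1
    in s 0 , from (φ⇔ 0 0 1) (refl , refl)

  -- `s x` accepts everything when `x` lies in the complement `C`, and nothing otherwise.
  S-hard : ∀ B → Π⁰ 1 B → B ≤ₘ S
  S-hard B ΠB =
    let C , ΣC , B⇔¬C = Π⁰₁-complement ΠB
        s , cs , φ⇔ = uniform-semidecider ΣC 1
        p , p∈M = M-inhabited
    in s , cs , λ x → mk⇔
      (λ b q accepted _ → to (B⇔¬C x) b (proj₂ (to (φ⇔ x q 1) accepted)))
      (λ sound → from (B⇔¬C x) λ c → sound p (from (φ⇔ x p 1) (refl , c)) p∈M)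

  Hᵢᵢᵢ-hard : ∀ d B → Π⁰ 1 B → B ≤ₘ Hᵢᵢᵢ d
  Hᵢᵢᵢ-hard d B ΠB =
    let C , ΣC , B⇔¬C = Π⁰₁-complement ΠB
        s , cs , φ⇔ = uniform-semidecider ΣC 1
    in s , cs , λ x → mk⇔
      (λ b (z , conv) → to (B⇔¬C x) b (proj₂ (to (φ⇔ x _ z) conv)))
      (λ diverges → from (B⇔¬C x) λ c → diverges (1 , from (φ⇔ x _ 1) (refl , c)))

  Hᵢ-hard : ∀ d B → Σ⁰ 1 B → B ≤ₘ Hᵢ d
  Hᵢ-hard d B ΣB =
    let s , cs , φ⇔ = uniform-semidecider ΣB 1
    in s , cs , λ x → mk⇔ (λ b → from (φ⇔ x _ 1) (refl , b)) (proj₂ ∘ to (φ⇔ x _ 1))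

  Hᵢᵢ-hard : ∀ d B → Σ⁰ 1 B → B ≤ₘ Hᵢᵢ d
  Hᵢᵢ-hard d B ΣB =
    -- The output 0 serves as a value other than 1.
    let s , cs , φ⇔ = uniform-semidecider ΣB 0
    in s , cs , λ x → mk⇔
      (λ b → 0 , from (φ⇔ x _ 0) (refl , b) , λ ())
      (λ (z , conv , _) → proj₂ (to (φ⇔ x _ z) conv))

  -- The input plays the universally quantified variable: `φ (s e)` searches for a witness of the
  -- inner existential statement at `x`, so it is total exactly when `B e` holds.
  Π⁰₂-semidecider : ∀ {B} → Π⁰ 2 B → ∀ y → ∃ λ s → Computable₁ s ×
                    (∀ e → B e → ∀ x → φ (s e) x y) ×
                    (∀ e → (∀ x → φ (s e) x ↓) → B e) ×
                    (∀ e x z → φ (s e) x z → z ≡ y)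
  Π⁰₂-semidecider (forAll {R = R} ΣR B⇔) y =
    -- The exchange is needed because `smn` puts the index first, whereas `R` has the quantified
    -- variable first.
    let s , cs , φ⇔ = semidecider (Σ⁰₁-preimage {P = R} ΣR (var 1F ◂ var 0F ◂ ε)) y
    in s , cs ,
      (λ e b x → from (φ⇔ e x y) (refl , to (B⇔ (e ∷ [])) b x)) ,
      (λ e total → from (B⇔ (e ∷ [])) λ x → let z , conv = total x in proj₂ (to (φ⇔ e x z) conv)) ,
      (λ e x z conv → proj₁ (to (φ⇔ e x z) conv))

  T-hard : ∀ B → Π⁰ 2 B → B ≤ₘ T
  T-hard B ΠB =
    let s , cs , total , reflects , _ = Π⁰₂-semidecider ΠB 1
    in s , cs , λ x → mk⇔ (λ b p → 1 , total x b p) (reflects x)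

  ET-hard : ∀ B → Π⁰ 2 B → B ≤ₘ ET
  ET-hard B ΠB =
    let s , cs , total , reflects , _ = Π⁰₂-semidecider ΠB 1
    in s , cs , λ x → mk⇔ (total x) (λ et → reflects x λ p → 1 , et p)

  T∩S-hard : ∀ B → Π⁰ 2 B → B ≤ₘ (T ∩ S)
  T∩S-hard B ΠB =
    -- With output 0 nothing is accepted: soundness is vacuous and totality alone decides
    -- membership.
    let s , cs , total , reflects , output = Π⁰₂-semidecider ΠB 0
    in s , cs , λ x → mk⇔
      (λ b → (λ p → 0 , total x b p) , λ p accepted _ → 1+n≢0 (output x p 1 accepted))
      (reflects x ∘ proj₁)

theorem8p1 : (𝒩 : AcceptableNumbering) → let open Adjudicators 𝒩 in
    (d : ℕ → ℕ) → IsDiagonal d →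
    (Π⁰ 1 -complete S)
    × (Π⁰ 2 -complete T × Π⁰ 2 -complete ET × Π⁰ 2 -complete (T ∩ S))
    × (Σ⁰ 1 -complete Hᵢ d × Σ⁰ 1 -complete Hᵢᵢ d × Π⁰ 1 -complete Hᵢᵢᵢ d)
theorem8p1 𝒩 d diagonal =
  (S-Π⁰₁ 𝒩 , S-hard 𝒩) ,
  ((T-Π⁰₂ 𝒩 , T-hard 𝒩) , (ET-Π⁰₂ 𝒩 , ET-hard 𝒩) , (T∩S-Π⁰₂ 𝒩 , T∩S-hard 𝒩)) ,
  ((Hᵢ-Σ⁰₁ 𝒩 d d-computable , Hᵢ-hard 𝒩 d) ,
   (Hᵢᵢ-Σ⁰₁ 𝒩 d d-computable , Hᵢᵢ-hard 𝒩 d) ,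
   (Hᵢᵢᵢ-Π⁰₁ 𝒩 d d-computable , Hᵢᵢᵢ-hard 𝒩 d))
  where open Adjudicators.IsDiagonal diagonal
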